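{- There is an infinite word $\mathbf{w}$ over the binary alphabet $\{0,1\}$ such that $\mathbf{w}$ is $3^+$-free and its curling-number transform $C(\mathbf{w})$ is overlap-free.
   Context: Words are indexed from $0$; infinite words are one-sided, $\mathbf{w} = \mathbf{w}[0]\mathbf{w}[1]\cdots$; $x[i..j]$ denotes the factor (contiguous block) $x[i]\cdots x[j]$. A finite word $x$ of length $n \ge 1$ has period $p$, $1\le p\le n$, if $x[i]=x[i+p]$ for all $0\le i<n-p$; its exponent is $n/p$ where $p$ is its least period. A finite or infinite word is $\alpha^+$-free if it has no nonempty finite factor of exponent strictly greater than $\alpha$. An overlap is a word of the form $a x a x a$ with $a$ a single letter and $x$ a possibly empty word; a word is overlap-free if it contains no overlap as a factor (equivalently, it is $2^+$-free). The curling number of a nonempty finite word $u$ is the largest integer $k \ge 1$ such that $u = y z^k$ for some (possibly empty) word $y$ and some nonempty word $z$. For a finite or infinite word $x$, the curling-number transform $C(x)$ is the word over the positive integers, of the same length as $x$, whose $i$-th letter $C(x)[i]$ is the curling number of the prefix $x[0..i]$. -}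

module Defs where

open import Data.Fin.Base using (Fin; toℕ)
import Data.Integer.Base as ℤ
open import Data.List.Base
  using (List; []; _∷_; [_]; _++_; length; lookup; take; drop; concat; replicate; applyUpTo)
import Data.List.Properties as List
open import Data.Nat.Base
  using (ℕ; zero; suc; _+_; _≤_; _<_; z≤n; s≤s; NonZero)
open import Data.Nat.Properties
  using (≤-refl; ≤-reflexive; ≤-trans; ≤-pred; ≤∧≢⇒<; +-mono-≤; anyUpTo?)
open import Data.Product using (Σ-syntax; ∃; ∃-syntax; ∃₂; _×_; _,_; proj₁)
open import Data.Rational.Base as ℚ using (ℚ)
open import Relation.Binary.Definitions using (DecidableEquality)
open import Relation.Binary.PropositionalEquality
  using (_≡_; _≢_; refl; sym; trans; cong; cong₂; subst)
open import Relation.Nullary using (¬_; Dec; yes; no; ¬?; contradiction)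
open import Relation.Nullary.Decidable using (map′; _×-dec_)

private
  variable
    A : Set

InfWord : Set → Set
InfWord A = ℕ → A

-- The factor of length n starting at position i, that is w[i..i+n-1].
factor : InfWord A → ℕ → ℕ → List A
factor w i n = applyUpTo (λ k → w (i + k)) n

IsFactorOf : List A → InfWord A → Set
IsFactorOf u w = ∃₂ λ i n → u ≡ factor w i n

HasPeriod : List A → ℕ → Set
HasPeriod u p =
  1 ≤ p × p ≤ length u ×
  (∀ (i j : Fin (length u)) → toℕ j ≡ toℕ i + p → lookup u i ≡ lookup u j)

IsLeastPeriod : List A → ℕ → Set
IsLeastPeriod u p = HasPeriod u p × (∀ q → HasPeriod u q → p ≤ q)

HasExponent : List A → ℚ → Set
HasExponent u e =
  ∃[ p ] Σ[ p≢0 ∈ NonZero p ]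
    IsLeastPeriod u p × e ≡ ℚ._/_ (ℤ.+ length u) p {{p≢0}}

-- α⁺-freeness: exponents equal to α are allowed.
_⁺-Free_ : ℚ → InfWord A → Set
α ⁺-Free w =
  ¬ (∃₂ λ u e → u ≢ [] × IsFactorOf u w × HasExponent u e × α ℚ.< e)

IsOverlap : List A → Set
IsOverlap u = ∃₂ λ a x → u ≡ [ a ] ++ x ++ [ a ] ++ x ++ [ a ]

OverlapFree : InfWord A → Set
OverlapFree w = ¬ (∃[ u ] IsFactorOf u w × IsOverlap u)

infixr 8 _^ʷ_
_^ʷ_ : List A → ℕ → List A
z ^ʷ k = concat (replicate k z)

EndsInPower : List A → ℕ → Set
EndsInPower u k = ∃₂ λ y z → z ≢ [] × u ≡ y ++ z ^ʷ k

IsCurlingNumber : List A → ℕ → Set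
IsCurlingNumber u k =
  1 ≤ k × EndsInPower u k × (∀ m → 1 ≤ m → EndsInPower u m → m ≤ k)

private
  take-length : (y r : List A) → take (length y) (y ++ r) ≡ y
  take-length []      r = refl
  take-length (a ∷ y) r = cong (a ∷_) (take-length y r)

  drop-length : (y r : List A) → drop (length y) (y ++ r) ≡ r
  drop-length []      r = refl
  drop-length (a ∷ y) r = drop-length y r

  nonempty-length : (z : List A) → z ≢ [] → 1 ≤ length z
  nonempty-length []      z≢[] = contradiction refl z≢[]
  nonempty-length (_ ∷ _) _    = s≤s z≤n

  length-^ʷ : (z : List A) → z ≢ [] → ∀ k → k ≤ length (z ^ʷ k)
  length-^ʷ z z≢[] zero    = z≤n
  length-^ʷ z z≢[] (suc k) =
    ≤-trans (+-mono-≤ (nonempty-length z z≢[]) (length-^ʷ z z≢[] k))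
            (≤-reflexive (sym (List.length-++ z)))

  EndsInPower⇒≤length : (u : List A) → ∀ k → EndsInPower u k → k ≤ length u
  EndsInPower⇒≤length u k (y , z , z≢[] , refl) =
    ≤-trans (length-^ʷ z z≢[] k) (List.length-++-≤ʳ (z ^ʷ k) {y})

  -- For k ≥ 1, y and z are determined by u and their lengths.
  Splits : List A → ℕ → ℕ → ℕ → Set
  Splits u k l n =
    take n (drop l u) ≢ [] × u ≡ take l u ++ take n (drop l u) ^ʷ k

  BoundedSplit : List A → ℕ → Set
  BoundedSplit u k =
    ∃[ l ] l < suc (length u) × ∃[ n ] n < suc (length u) × Splits u k l n

  BoundedSplit⇒EndsInPower : (u : List A) → ∀ k → BoundedSplit u k → EndsInPower u k
  BoundedSplit⇒EndsInPower u k (l , _ , n , _ , z≢[] , eq) =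
    take l u , take n (drop l u) , z≢[] , eq

  EndsInPower⇒BoundedSplit :
    (u : List A) → ∀ k → EndsInPower u (suc k) → BoundedSplit u (suc k)
  EndsInPower⇒BoundedSplit u k (y , z , z≢[] , refl) =
    length y , s≤s (List.length-++-≤ˡ y) ,
    length z , s≤s (≤-trans (List.length-++-≤ˡ z) (List.length-++-≤ʳ (z ^ʷ suc k) {y})) ,
    (λ z′≡[] → z≢[] (trans (sym z-eq) z′≡[])) ,
    sym (cong₂ (λ y′ z′ → y′ ++ z′ ^ʷ suc k) (take-length y (z ^ʷ suc k)) z-eq)
    where
    z-eq : take (length z) (drop (length y) (y ++ z ^ʷ suc k)) ≡ z
    z-eq = trans (cong (take (length z)) (drop-length y (z ^ʷ suc k)))
                 (take-length z (z ^ʷ k))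

  endsInPower? : DecidableEquality A → (u : List A) → ∀ k → Dec (EndsInPower u (suc k))
  endsInPower? _≟_ u k =
    map′ (BoundedSplit⇒EndsInPower u (suc k)) (EndsInPower⇒BoundedSplit u k)
      (anyUpTo? (λ l → anyUpTo? (λ n →
          ¬? (List.≡-dec _≟_ (take n (drop l u)) []) ×-dec
          List.≡-dec _≟_ u (take l u ++ take n (drop l u) ^ʷ suc k))
        (suc (length u))) (suc (length u)))

  largest : (P : ℕ → Set) → (∀ k → Dec (P (suc k))) → P 1 →
            ∀ N → (∀ m → 1 ≤ m → P m → m ≤ N) →
            ∃[ k ] 1 ≤ k × P k × (∀ m → 1 ≤ m → P m → m ≤ k)
  largest P P? P1 zero bound with () ← bound 1 ≤-refl P1
  largest P P? P1 (suc N) bound with P? N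
  ... | yes PN = suc N , s≤s z≤n , PN , bound
  ... | no ¬PN = largest P P? P1 N λ m 1≤m Pm →
    ≤-pred (≤∧≢⇒< (bound m 1≤m Pm) λ m≡1+N → ¬PN (subst P m≡1+N Pm))

curlingNumber : DecidableEquality A → (u : List A) → u ≢ [] → ∃ (IsCurlingNumber u)
curlingNumber _≟_ u u≢[] =
  largest (EndsInPower u) (endsInPower? _≟_ u)
    ([] , u , u≢[] , sym (List.++-identityʳ u))
    (length u) (λ m _ → EndsInPower⇒≤length u m)

curlingTransform : DecidableEquality A → InfWord A → InfWord ℕ
curlingTransform _≟_ w i = proj₁ (curlingNumber _≟_ (factor w 0 (suc i)) λ ())

{-# OPTIONS --safe #-}
module Submission where

-- Let t be the square-free ternary fixed point of Leech's 13-uniform morphism and h the 16-uniform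
-- morphism below.  All squares in h t have period 1 or 2, so each letter of C (h t) is read off a
-- bounded window, and C (h t) is again a 16-uniform image g t.  All three morphisms are handled by
-- one desubstitution argument.  A repetition whose period is less than two block lengths k lies in
-- the image of five letters, which is a finite check.  For a longer period, no block occurs across
-- a boundary inside the image of two letters, so the period is m k, and since blocks are determined
-- both by short prefixes and by short suffixes, t would contain a square of period m.

open import Data.Empty using (⊥-elim)
open import Data.Fin.Base using (Fin; toℕ; fromℕ<)
open import Data.Fin.Patterns using (0F; 1F; 2F)
open import Data.Fin.Properties using (_≟_; all?; toℕ-fromℕ<)
open import Data.Integer.Base using (+_)
import Data.Integer.Base as ℤ
import Data.Integer.Properties as ℤ
open import Data.List.Base using (List; []; _∷_; _++_; length; lookup; applyUpTo)
open import Data.List.Properties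
  using (∷-injectiveˡ; ∷-injectiveʳ; length-applyUpTo; lookup-applyUpTo; ++-identityʳ; ++-assoc; length-++)
open import Data.Nat.Base hiding (_/_; _%_)
import Data.Nat.Base as ℕ
open import Data.Nat.DivMod
  using ([m+kn]%n≡m%n; m≡m%n+[m/n]*n; m%n<n; m*n/n≡m; m<n⇒m%n≡m; m<n⇒m/n≡0;
         m<n*o⇒m/o<n; m/n<m; m/n≤m; +-distrib-/-∣ˡ; m≥n⇒m/n>0)
open import Data.Nat.Divisibility using (n∣m*n)
open import Data.Nat.Induction using (<-rec)
import Data.Nat.Properties as ℕ
open import Data.Nat.Properties hiding (_≟_)
open import Algebra.Properties.CommutativeSemigroup +-commutativeSemigroup using (xy∙z≈xz∙y)
open import Data.Nat.Tactic.RingSolver using (solve-∀)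
open import Data.Product using (Σ-syntax; ∃-syntax; ∃₂; _×_; _,_; proj₁; proj₂)
open import Data.Rational.Base using (_/_)
import Data.Rational.Base as ℚ
import Data.Rational.Properties as ℚ
import Data.Rational.Unnormalised.Base as ℚᵘ
import Data.Rational.Unnormalised.Properties as ℚᵘ
open import Data.Sum.Base using (_⊎_; inj₁; inj₂)
open import Function.Base using (_∘_)
open import Relation.Binary.Definitions using (DecidableEquality)
open import Relation.Binary.PropositionalEquality
open import Relation.Nullary using (¬_; Dec; yes; no; ¬?; contradiction)
open import Relation.Nullary.Decidable using (map′; toWitness; _→-dec_; _×-dec_; _⊎-dec_)
open import Defs

-- Repetitions in infinite words.

private
  variable
    A : Set
    w w′ : InfWord A

-- The factor of length `p + m` at `i` has period `p`. For positive `p`, `m = p` gives a square,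
-- `m = suc p` an overlap, and `m = k * p` a power of exponent `suc k`.
record Repeats (w : InfWord A) (i p m : ℕ) : Set where
  constructor repeats
  field
    shift-eq : ∀ {j} → j < m → w (i + j) ≡ w (i + p + j)

open Repeats

repeats? : DecidableEquality A → (w : InfWord A) → ∀ i p m → Dec (Repeats w i p m)
repeats? _≟ᴬ_ w i p m = map′ repeats shift-eq (allUpTo? (λ j → w (i + j) ≟ᴬ w (i + p + j)) m)

Repeats-≤ : ∀ {i p m n} → m ≤ n → Repeats w i p n → Repeats w i p m
Repeats-≤ m≤n rep = repeats λ j<m → shift-eq rep (<-≤-trans j<m m≤n)

-- Only `p + m` consecutive letters matter, so a repetition moves to any word showing the same
-- window. This carries infinite words to finite checks.
Repeats-transfer : ∀ {i i′ p m} → (∀ {j} → j < p + m → w (i + j) ≡ w′ (i′ + j)) →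
                   Repeats w i p m → Repeats w′ i′ p m
Repeats-transfer {w = w} {w′ = w′} {i} {i′} {p} {m} eq rep = repeats λ {j} j<m → begin
  w′ (i′ + j)        ≡⟨ eq (<-≤-trans j<m (m≤n+m m p)) ⟨
  w (i + j)         ≡⟨ shift-eq rep j<m ⟩
  w (i + p + j)     ≡⟨ cong w (+-assoc i p j) ⟩
  w (i + (p + j))   ≡⟨ eq (+-monoʳ-< p j<m) ⟩
  w′ (i′ + (p + j))  ≡⟨ cong w′ (+-assoc i′ p j) ⟨
  w′ (i′ + p + j)    ∎
  where open ≡-Reasoning

Repeats-at : ∀ {i p m y} → Repeats w i p m → i ≤ y → y < i + m → w y ≡ w (y + p)
Repeats-at {w = w} {i} {p} {m} {y} rep i≤y y<i+m = begin
  w y                  ≡⟨ cong w (m+[n∸m]≡n i≤y) ⟨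
  w (i + (y ∸ i))      ≡⟨ shift-eq rep
    (+-cancelˡ-< i _ _ (subst (_< i + m) (sym (m+[n∸m]≡n i≤y)) y<i+m)) ⟩
  w (i + p + (y ∸ i))  ≡⟨ cong w (xy∙z≈xz∙y i p (y ∸ i)) ⟩
  w (i + (y ∸ i) + p)  ≡⟨ cong (λ x → w (x + p)) (m+[n∸m]≡n i≤y) ⟩
  w (y + p)            ∎
  where open ≡-Reasoning

-- Uniform morphisms and windows of a few letters.

pad : List A → A → InfWord A
pad []       d n       = d
pad (x ∷ xs) d zero    = x
pad (x ∷ xs) d (suc n) = pad xs d n

-- The image of a word under the k-uniform morphism whose block f a has letters f a 0 … f a (k ∸ 1).
image : (k : ℕ) .{{_ : NonZero k}} → (Fin 3 → ℕ → A) → InfWord (Fin 3) → InfWord A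
image k f t n = f (t (n ℕ./ k)) (n ℕ.% k)

module _ (k : ℕ) .{{_ : NonZero k}} (f : Fin 3 → ℕ → A) where

  image-shift : ∀ t q j → image k f t (q * k + j) ≡ image k f (λ x → t (q + x)) j
  image-shift t q j = cong₂ (λ x → f (t x))
    (trans (+-distrib-/-∣ˡ j (n∣m*n q)) (cong (_+ j ℕ./ k) (m*n/n≡m q k)))
    (trans (cong (ℕ._% k) (+-comm (q * k) j)) ([m+kn]%n≡m%n j q k))

  image-block : ∀ t q {j} → j < k → image k f t (q * k + j) ≡ f (t q) j
  image-block t q {j} j<k = trans (image-shift t q j)
    (cong₂ (λ x → f (t x)) (trans (cong (λ x → q + x) (m<n⇒m/n≡0 j<k)) (+-identityʳ q)) (m<n⇒m%n≡m j<k))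

  image-cong : ∀ {t u} n → (∀ {x} → x < n → t x ≡ u x) →
               ∀ {j} → j < n * k → image k f t j ≡ image k f u j
  image-cong n eq {j} j<nk = cong (λ a → f a (j ℕ.% k)) (eq (m<n*o⇒m/o<n {j} {n} {k} j<nk))

position : ∀ n k .{{_ : NonZero k}} → n ≡ (n ℕ./ k) * k + n ℕ.% k
position n k = trans (m≡m%n+[m/n]*n n k) (+-comm (n ℕ.% k) _)

-- The last letter doubles as the default of `pad`, here, in `quintuple` and in the blocks below;
-- the checks read no position beyond it.
pair : Fin 3 → Fin 3 → InfWord (Fin 3)
pair a b = pad (a ∷ []) b

pair-window : ∀ (t : InfWord (Fin 3)) {x} → x < 2 → t x ≡ pair (t 0) (t 1) x
pair-window t {0} _ = refl
pair-window t {1} _ = refl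
pair-window t {suc (suc _)} (s≤s (s≤s ()))

quintuple : (a b c d e : Fin 3) → InfWord (Fin 3)
quintuple a b c d e = pad (a ∷ b ∷ c ∷ d ∷ []) e

quintuple-window : ∀ (t : InfWord (Fin 3)) {x} → x < 5 →
                   t x ≡ quintuple (t 0) (t 1) (t 2) (t 3) (t 4) x
quintuple-window t {0} _ = refl
quintuple-window t {1} _ = refl
quintuple-window t {2} _ = refl
quintuple-window t {3} _ = refl
quintuple-window t {4} _ = refl
quintuple-window t {suc (suc (suc (suc (suc _))))} (s≤s (s≤s (s≤s (s≤s (s≤s ())))))

-- Finite conditions on a morphism.

NoShortSquare : InfWord (Fin 3) → Set
NoShortSquare t = ∀ {p} → p < 3 → 1 ≤ p → ∀ i → ¬ Repeats t i p p

-- A square within five letters has period at most 2, so these periods express square-freeness of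
-- the whole window.
SquareFree₅ : InfWord (Fin 3) → Set
SquareFree₅ u = ∀ {p} → p < 3 → 1 ≤ p → ∀ {i} → i < 5 → i + (p + p) ≤ 5 → ¬ Repeats u i p p

squareFree₅? : ∀ u → Dec (SquareFree₅ u)
squareFree₅? u = allUpTo? (λ p → (1 ≤? p) →-dec allUpTo? (λ i → (i + (p + p) ≤? 5) →-dec
  ¬? (repeats? _≟_ u i p p)) 5) 3

-- e p is the forbidden length of agreement between the word and its shift by p: squares are avoided
-- when e p = p, overlaps when e p = p + 1.
module _ {A : Set} (k : ℕ) .{{_ : NonZero k}} (f : Fin 3 → ℕ → A) where

  Short : (ℕ → ℕ) → Set
  Short e = ∀ a b c d g → let u = quintuple a b c d g in SquareFree₅ u →
    ∀ {i} → i < k → ∀ {p} → p < 2 * k → 1 ≤ p → ¬ Repeats (image k f u) i p (e p)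

  Synchronizing : Set
  Synchronizing = ∀ a b c {r} → r < k →
    (∀ {j} → j < k → f a j ≡ image k f (pair b c) (r + j)) → r ≡ 0

  PrefixInjective : ℕ → Set
  PrefixInjective cut = ∀ a b → (∀ {j} → j < cut → f a j ≡ f b j) → a ≡ b

  SuffixInjective : ℕ → Set
  SuffixInjective cut = ∀ a b → (∀ {j} → j < k ∸ cut → f a (cut + j) ≡ f b (cut + j)) → a ≡ b

  module _ (_≟ᴬ_ : DecidableEquality A) where

    short? : ∀ e → Dec (Short e)
    short? e = all? λ a → all? λ b → all? λ c → all? λ d → all? λ g →
      let u = quintuple a b c d g in
      squareFree₅? u →-dec
      allUpTo? (λ i → allUpTo? (λ p → (1 ≤? p) →-dec
        ¬? (repeats? _≟ᴬ_ (image k f u) i p (e p))) (2 * k)) k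

    synchronizing? : Dec Synchronizing
    synchronizing? = all? λ a → all? λ b → all? λ c →
      allUpTo? (λ r → allUpTo? (λ j → f a j ≟ᴬ image k f (pair b c) (r + j)) k →-dec
        (r ℕ.≟ 0)) k

    prefixInjective? : ∀ cut → Dec (PrefixInjective cut)
    prefixInjective? cut = all? λ a → all? λ b →
      allUpTo? (λ j → f a j ≟ᴬ f b j) cut →-dec (a ≟ b)

    suffixInjective? : ∀ cut → Dec (SuffixInjective cut)
    suffixInjective? cut = all? λ a → all? λ b →
      allUpTo? (λ j → f a (cut + j) ≟ᴬ f b (cut + j)) (k ∸ cut) →-dec (a ≟ b)

-- An offset below `k` followed by a repetition of length `p + e p` must stay inside the five blocks
-- examined by `Short`.
FitsInFiveBlocks : ℕ → (ℕ → ℕ) → Set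
FitsInFiveBlocks k e = ∀ {p} → p < 2 * k → k + (p + e p) ≤ 5 * k

fitsInFiveBlocks? : ∀ k e → Dec (FitsInFiveBlocks k e)
fitsInFiveBlocks? k e = allUpTo? (λ p → k + (p + e p) ≤? 5 * k) (2 * k)

-- `cut` splits each block into a prefix and a suffix, either of which determines the letter.
-- `p≤e[p]` makes every long forbidden repetition contain a square, which is what gets
-- desubstituted.
record Admissible {A : Set} (k : ℕ) .{{_ : NonZero k}} (f : Fin 3 → ℕ → A) (e : ℕ → ℕ) : Set where
  field
    cut       : ℕ
    cut≤k     : cut ≤ k
    short     : Short k f e
    sync      : Synchronizing k f
    prefix    : PrefixInjective k f cut
    suffix    : SuffixInjective k f cut
    fits      : FitsInFiveBlocks k e
    p≤e[p]    : ∀ {p} → 2 * k ≤ p → p ≤ e p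

-- Desubstitution of repetitions.

module Avoidance {A : Set} (k : ℕ) .{{_ : NonZero k}} (f : Fin 3 → ℕ → A) {e : ℕ → ℕ}
                 (adm : Admissible k f e) (t : InfWord (Fin 3)) where
  open Admissible adm

  private
    W : InfWord A
    W = image k f t

  noShortRepetition : NoShortSquare t → ∀ i {p} → p < 2 * k → 1 ≤ p → ¬ Repeats W i p (e p)
  noShortRepetition noSq i {p} p<2k 1≤p rep =
    short _ _ _ _ _ squareFree (m%n<n i k) p<2k 1≤p (Repeats-transfer window rep)
    where
    q r : ℕ
    q = i ℕ./ k
    r = i ℕ.% k

    t′ u : InfWord (Fin 3)
    t′ x = t (q + x)
    u = quintuple (t′ 0) (t′ 1) (t′ 2) (t′ 3) (t′ 4)

    squareFree : SquareFree₅ u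
    squareFree {p} p<3 1≤p {i} _ i+2p≤5 sq = noSq p<3 1≤p (q + i)
      (Repeats-transfer
        (λ {j} j<2p → trans (sym (quintuple-window t′ (<-≤-trans (+-monoʳ-< i j<2p) i+2p≤5)))
                            (cong t (sym (+-assoc q i j))))
        sq)

    window : ∀ {j} → j < p + e p → W (i + j) ≡ image k f u (r + j)
    window {j} j<p+e = begin
      W (i + j)              ≡⟨ cong (λ x → W (x + j)) (position i k) ⟩
      W (q * k + r + j)      ≡⟨ cong W (+-assoc (q * k) r j) ⟩
      W (q * k + (r + j))    ≡⟨ image-shift k f t q (r + j) ⟩
      image k f t′ (r + j)   ≡⟨ image-cong k f 5 (quintuple-window t′)
                                 (<-≤-trans (+-mono-< (m%n<n i k) j<p+e) (fits p<2k)) ⟩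
      image k f u (r + j)    ∎
      where open ≡-Reasoning

  -- A block boundary Q k lies within distance k of i, so the block at Q k reappears at Q k + p.
  period-multiple : ∀ i {p} → 2 * k ≤ p → Repeats W i p p → p ≡ (p ℕ./ k) * k
  period-multiple i {p} 2k≤p rep = trans (position p k)
    (trans (cong (λ x → (p ℕ./ k) * k + x) r≡0) (+-identityʳ _))
    where
    Q m r : ℕ
    Q = suc (i ℕ./ k)
    m = p ℕ./ k
    r = p ℕ.% k

    i≤Qk : i ≤ Q * k
    i≤Qk = begin
      i                            ≡⟨ position i k ⟩
      (i ℕ./ k) * k + i ℕ.% k      ≤⟨ +-monoʳ-≤ _ (<⇒≤ (m%n<n i k)) ⟩
      (i ℕ./ k) * k + k            ≡⟨ +-comm _ k ⟩
      Q * k                        ∎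
      where open ≤-Reasoning

    -- Block `Q` ends at most `2 * k` letters after `i`, hence within the first period.
    Qk+j<i+p : ∀ {j} → j < k → Q * k + j < i + p
    Qk+j<i+p {j} j<k = begin-strict
      Q * k + j                    <⟨ +-monoʳ-< (Q * k) j<k ⟩
      Q * k + k                    ≡⟨ regroup k (i ℕ./ k) ⟩
      (i ℕ./ k) * k + 2 * k        ≤⟨ +-mono-≤ (m≤m+n _ (i ℕ.% k)) 2k≤p ⟩
      (i ℕ./ k) * k + i ℕ.% k + p  ≡⟨ cong (_+ p) (position i k) ⟨
      i + p                        ∎
      where
      open ≤-Reasoning
      regroup : ∀ k n → k + n * k + k ≡ n * k + 2 * k
      regroup = solve-∀

    t′ : InfWord (Fin 3)
    t′ x = t (Q + m + x)

    -- As `p` is `m * k + r`, the copy of block `Q` starts at offset `r` of block `Q + m` and may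
    -- spill into the next block; `sync` then forces `r` to be 0.
    overlay : ∀ {j} → j < k → f (t Q) j ≡ image k f (pair (t′ 0) (t′ 1)) (r + j)
    overlay {j} j<k = begin
      f (t Q) j                   ≡⟨ image-block k f t Q j<k ⟨
      W (Q * k + j)               ≡⟨ Repeats-at rep (≤-trans i≤Qk (m≤m+n _ j)) (Qk+j<i+p j<k) ⟩
      W (Q * k + j + p)           ≡⟨ cong (λ x → W (Q * k + j + x)) (position p k) ⟩
      W (Q * k + j + (m * k + r)) ≡⟨ cong W (regroup k Q j m r) ⟩
      W ((Q + m) * k + (r + j))   ≡⟨ image-shift k f t (Q + m) (r + j) ⟩
      image k f t′ (r + j)        ≡⟨ image-cong k f 2 (pair-window t′) r+j<2k ⟩
      image k f (pair (t′ 0) (t′ 1)) (r + j) ∎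
      where
      open ≡-Reasoning
      regroup : ∀ k Q j m r → Q * k + j + (m * k + r) ≡ (Q + m) * k + (r + j)
      regroup = solve-∀
      r+j<2k : r + j < 2 * k
      r+j<2k = subst (r + j <_) (cong (λ x → k + x) (sym (+-identityʳ k))) (+-mono-< (m%n<n p k) j<k)

    r≡0 : r ≡ 0
    r≡0 = sync _ _ _ (m%n<n p k) overlay

  -- The bounds concern a single position, so blocks only partly covered by the square can be
  -- compared on their covered letters.
  block-repeats : ∀ {i m} → Repeats W i (m * k) (m * k) → ∀ Q {j} → j < k →
                  i ≤ Q * k + j → Q * k + j < i + m * k → f (t Q) j ≡ f (t (Q + m)) j
  block-repeats {i} {m} rep Q {j} j<k i≤y y<i+p = begin
    f (t Q) j              ≡⟨ image-block k f t Q j<k ⟨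
    W (Q * k + j)          ≡⟨ Repeats-at rep i≤y y<i+p ⟩
    W (Q * k + j + m * k)  ≡⟨ cong W (regroup k Q j m) ⟩
    W ((Q + m) * k + j)    ≡⟨ image-block k f t (Q + m) j<k ⟩
    f (t (Q + m)) j        ∎
    where
    open ≡-Reasoning
    regroup : ∀ k Q j m → Q * k + j + m * k ≡ (Q + m) * k + j
    regroup = solve-∀

  -- A letter is determined by its block on either side of the cut, so one of the two partial blocks
  -- at the ends of a square of period m k completes a square of period m in t.
  desubstitute : ∀ i m → Repeats W i (m * k) (m * k) → ∃[ i′ ] Repeats t i′ m m
  desubstitute i m rep with ≤-total (i ℕ.% k) cut
  -- Block `q` is covered from `cut` on, so the square in `t` starts at `q` and letters are
  -- recovered from suffixes.
  ... | inj₁ s≤cut = q , repeats λ {x} x<m → trans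
    (suffix (t (q + x)) (t (q + x + m)) λ {j} j<k∸cut →
      block-repeats rep (q + x) (cut+j<k j<k∸cut) (lower x j) (upper x<m j<k∸cut))
    (cong t (xy∙z≈xz∙y q x m))
    where
    open ≤-Reasoning
    q s : ℕ
    q = i ℕ./ k
    s = i ℕ.% k

    cut+j<k : ∀ {j} → j < k ∸ cut → cut + j < k
    cut+j<k {j} j<k∸cut = subst (cut + j <_) (m+[n∸m]≡n cut≤k) (+-monoʳ-< cut j<k∸cut)

    lower : ∀ x j → i ≤ (q + x) * k + (cut + j)
    lower x j = begin
      i                        ≡⟨ position i k ⟩
      q * k + s                ≤⟨ +-mono-≤ (*-monoˡ-≤ k (m≤m+n q x)) (≤-trans s≤cut (m≤m+n cut j)) ⟩
      (q + x) * k + (cut + j)  ∎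

    upper : ∀ {x j} → x < m → j < k ∸ cut → (q + x) * k + (cut + j) < i + m * k
    upper {x} {j} x<m j<k∸cut = begin-strict
      (q + x) * k + (cut + j)  <⟨ +-monoʳ-< ((q + x) * k) (cut+j<k j<k∸cut) ⟩
      (q + x) * k + k          ≡⟨ regroup q x k ⟩
      q * k + suc x * k        ≤⟨ +-mono-≤ (m≤m+n _ s) (*-monoˡ-≤ k x<m) ⟩
      q * k + s + m * k        ≡⟨ cong (_+ m * k) (position i k) ⟨
      i + m * k                ∎
      where
      regroup : ∀ q x k → (q + x) * k + k ≡ q * k + (k + x * k)
      regroup = solve-∀
  -- The square in `t` starts at the next block. Its last compared block, `q + m`, is covered up to
  -- `s`, hence up to `cut`, so prefixes suffice.
  ... | inj₂ cut≤s = suc q , repeats λ {x} x<m → trans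
    (prefix (t (suc q + x)) (t (suc q + x + m)) λ {j} j<cut →
      block-repeats rep (suc q + x) (<-≤-trans j<cut cut≤k) (lower x j) (upper x<m j<cut))
    (cong t (xy∙z≈xz∙y (suc q) x m))
    where
    open ≤-Reasoning
    q s : ℕ
    q = i ℕ./ k
    s = i ℕ.% k

    lower : ∀ x j → i ≤ (suc q + x) * k + j
    lower x j = begin
      i                    ≡⟨ position i k ⟩
      q * k + s            ≤⟨ +-monoʳ-≤ (q * k) (<⇒≤ (m%n<n i k)) ⟩
      q * k + k            ≡⟨ +-comm (q * k) k ⟩
      suc q * k            ≤⟨ *-monoˡ-≤ k (m≤m+n (suc q) x) ⟩
      (suc q + x) * k      ≤⟨ m≤m+n _ j ⟩
      (suc q + x) * k + j  ∎

    upper : ∀ {x j} → x < m → j < cut → (suc q + x) * k + j < i + m * k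
    upper {x} {j} x<m j<cut = begin-strict
      (suc q + x) * k + j    <⟨ +-monoʳ-< ((suc q + x) * k) (<-≤-trans j<cut cut≤s) ⟩
      (suc q + x) * k + s    ≡⟨ regroup q x k s ⟩
      q * k + s + suc x * k  ≤⟨ +-monoʳ-≤ (q * k + s) (*-monoˡ-≤ k x<m) ⟩
      q * k + s + m * k      ≡⟨ cong (_+ m * k) (position i k) ⟨
      i + m * k              ∎
      where
      regroup : ∀ q x k s → k + (q + x) * k + s ≡ q * k + s + (k + x * k)
      regroup = solve-∀

  -- Short periods are impossible, so `p` is long. The equation `p ≡ m * k` is returned for the
  -- descent in `t-squareFree`.
  repetition⇒square : NoShortSquare t → ∀ {i p} → 1 ≤ p → Repeats W i p (e p) →
                      ∃₂ λ i′ m → 1 ≤ m × p ≡ m * k × Repeats t i′ m m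
  repetition⇒square noSq {i} {p} 1≤p rep with p <? 2 * k
  ... | yes p<2k = ⊥-elim (noShortRepetition noSq i p<2k 1≤p rep)
  ... | no  p≮2k = i′ , m , m≥n⇒m/n>0 (≤-trans (m≤m+n k _) 2k≤p) , p≡mk , sq
    where
    2k≤p : 2 * k ≤ p
    2k≤p = ≮⇒≥ p≮2k

    m : ℕ
    m = p ℕ./ k

    W-square : Repeats W i p p
    W-square = Repeats-≤ (p≤e[p] 2k≤p) rep

    p≡mk : p ≡ m * k
    p≡mk = period-multiple i 2k≤p W-square

    t-square : ∃[ i′ ] Repeats t i′ m m
    t-square = desubstitute i m (subst (λ n → Repeats W i n n) p≡mk W-square)

    i′ : ℕ
    i′ = proj₁ t-square

    sq : Repeats t i′ m m
    sq = proj₂ t-square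

-- The three morphisms.

leech : Fin 3 → ℕ → Fin 3
leech 0F = pad (0F ∷ 1F ∷ 2F ∷ 1F ∷ 0F ∷ 2F ∷ 1F ∷ 2F ∷ 0F ∷ 1F ∷ 2F ∷ 1F ∷ []) 0F
leech 1F = pad (1F ∷ 2F ∷ 0F ∷ 2F ∷ 1F ∷ 0F ∷ 2F ∷ 0F ∷ 1F ∷ 2F ∷ 0F ∷ 2F ∷ []) 1F
leech 2F = pad (2F ∷ 0F ∷ 1F ∷ 0F ∷ 2F ∷ 1F ∷ 0F ∷ 1F ∷ 2F ∷ 0F ∷ 1F ∷ 0F ∷ []) 2F

h : Fin 3 → ℕ → Fin 2
h 0F = pad (0F ∷ 0F ∷ 0F ∷ 1F ∷ 0F ∷ 1F ∷ 1F ∷ 1F ∷ 0F ∷ 0F ∷ 1F ∷ 0F ∷ 1F ∷ 0F ∷ 1F ∷ []) 1F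
h 1F = pad (0F ∷ 0F ∷ 0F ∷ 1F ∷ 1F ∷ 0F ∷ 1F ∷ 0F ∷ 0F ∷ 0F ∷ 1F ∷ 0F ∷ 1F ∷ 0F ∷ 1F ∷ []) 1F
h 2F = pad (0F ∷ 0F ∷ 1F ∷ 0F ∷ 1F ∷ 1F ∷ 1F ∷ 0F ∷ 0F ∷ 0F ∷ 1F ∷ 0F ∷ 1F ∷ 0F ∷ 1F ∷ []) 1F

-- C (h t) = g t, since no square in h t of period at most 2 crosses a block boundary.
g : Fin 3 → ℕ → ℕ
g 0F = pad (1 ∷ 2 ∷ 3 ∷ 1 ∷ 1 ∷ 2 ∷ 2 ∷ 3 ∷ 1 ∷ 2 ∷ 1 ∷ 1 ∷ 2 ∷ 2 ∷ 3 ∷ []) 2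
g 1F = pad (1 ∷ 2 ∷ 3 ∷ 1 ∷ 2 ∷ 1 ∷ 1 ∷ 2 ∷ 2 ∷ 3 ∷ 1 ∷ 1 ∷ 2 ∷ 2 ∷ 3 ∷ []) 2
g 2F = pad (1 ∷ 2 ∷ 1 ∷ 1 ∷ 2 ∷ 2 ∷ 3 ∷ 1 ∷ 2 ∷ 3 ∷ 1 ∷ 1 ∷ 2 ∷ 2 ∷ 3 ∷ []) 2

-- Exponents above 3 are forbidden at periods 1 and 2, squares at all larger periods.
hBound : ℕ → ℕ
hBound 1 = 3
hBound 2 = 5
hBound p = p

hBound-id : ∀ {p} → 3 ≤ p → hBound p ≡ p
hBound-id {suc (suc (suc p))} _ = refl
hBound-id {2} (s≤s (s≤s ()))
hBound-id {1} (s≤s ())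

-- Agreement over `suc (p + p)` letters means length `suc (3 * p)`, the least length exceeding three
-- periods.
hBound≤ : ∀ {p} → 1 ≤ p → hBound p ≤ suc (p + p)
hBound≤ {1} _ = ≤-refl
hBound≤ {2} _ = ≤-refl
hBound≤ {suc (suc (suc p))} _ = m≤n⇒m≤1+n (m≤m+n _ _)

leech-admissible : Admissible 13 leech (λ p → p)
leech-admissible = record
  -- Each block `leech a` begins and ends with `a`.
  { cut    = 1
  ; cut≤k  = s≤s z≤n
  ; short  = toWitness {a? = short? 13 leech _≟_ (λ p → p)} _
  ; sync   = toWitness {a? = synchronizing? 13 leech _≟_} _
  ; prefix = toWitness {a? = prefixInjective? 13 leech _≟_ 1} _
  ; suffix = toWitness {a? = suffixInjective? 13 leech _≟_ 1} _
  ; fits   = toWitness {a? = fitsInFiveBlocks? 13 (λ p → p)} _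
  ; p≤e[p] = λ _ → ≤-refl
  }

h-admissible : Admissible 16 h hBound
h-admissible = record
  -- The only possible cut: `h 0F` and `h 1F` share their first four letters, while `h 1F` and
  -- `h 2F` agree from index 6 on.
  { cut    = 5
  ; cut≤k  = m≤m+n 5 11
  ; short  = toWitness {a? = short? 16 h _≟_ hBound} _
  ; sync   = toWitness {a? = synchronizing? 16 h _≟_} _
  ; prefix = toWitness {a? = prefixInjective? 16 h _≟_ 5} _
  ; suffix = toWitness {a? = suffixInjective? 16 h _≟_ 5} _
  ; fits   = toWitness {a? = fitsInFiveBlocks? 16 hBound} _
  ; p≤e[p] = λ 32≤p → ≤-reflexive (sym (hBound-id (≤-trans (m≤m+n 3 29) 32≤p)))
  }

g-admissible : Admissible 16 g suc
g-admissible = record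
  -- The least possible cut, since `g 0F` and `g 1F` share their first four letters.
  { cut    = 5
  ; cut≤k  = m≤m+n 5 11
  ; short  = toWitness {a? = short? 16 g ℕ._≟_ suc} _
  ; sync   = toWitness {a? = synchronizing? 16 g ℕ._≟_} _
  ; prefix = toWitness {a? = prefixInjective? 16 g ℕ._≟_ 5} _
  ; suffix = toWitness {a? = suffixInjective? 16 g ℕ._≟_ 5} _
  ; fits   = toWitness {a? = fitsInFiveBlocks? 16 suc} _
  ; p≤e[p] = λ _ → n≤1+n _
  }

-- A square-free ternary word.

-- The first argument bounds the number of applications of leech; it only has to be at least n.
iterate-leech : ℕ → InfWord (Fin 3)
iterate-leech zero    n = 0F
iterate-leech (suc m) n = leech (iterate-leech m (n ℕ./ 13)) (n ℕ.% 13)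

t : InfWord (Fin 3)
t n = iterate-leech n n

-- Division by 13 decreases the position until it is 0. Surplus applications then act at position 0,
-- where `leech 0F 0` reduces to `0F`.
iterate-leech-stable : ∀ {a b n} → n ≤ a → n ≤ b → iterate-leech a n ≡ iterate-leech b n
iterate-leech-stable {zero}  {zero}  z≤n z≤n = refl
iterate-leech-stable {zero}  {suc b} z≤n z≤n =
  cong (λ x → leech x 0) (iterate-leech-stable {zero} {b} z≤n z≤n)
iterate-leech-stable {suc a} {zero}  z≤n z≤n =
  cong (λ x → leech x 0) (iterate-leech-stable {a} {zero} z≤n z≤n)
iterate-leech-stable {suc a} {suc b} {n} n≤1+a n≤1+b =
  cong (λ x → leech x (n ℕ.% 13)) (iterate-leech-stable (bound n≤1+a) (bound n≤1+b))
  where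
  bound : ∀ {n c} → n ≤ suc c → n ℕ./ 13 ≤ c
  bound {zero}  _     = z≤n
  bound {suc n} n≤1+c = ≤-pred (<-≤-trans (m/n<m (suc n) 13 (s≤s (s≤s z≤n))) n≤1+c)

t-fixed : ∀ n → t n ≡ image 13 leech t n
t-fixed n = trans (iterate-leech-stable ≤-refl (n≤1+n n))
  (cong (λ x → leech x (n ℕ.% 13)) (iterate-leech-stable (m/n≤m n 13) ≤-refl))

-- The five-letter checks presuppose `NoShortSquare t`, so that comes first, from two blocks at a
-- time: a square of period at most 2 spans at most four letters.
PairSquareFree : Set
PairSquareFree = ∀ a b → a ≢ b → ∀ {p} → p < 3 → 1 ≤ p → ∀ {r} → r < 13 →
                 ¬ Repeats (image 13 leech (pair a b)) r p p

leech-pairSquareFree : PairSquareFree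
leech-pairSquareFree = toWitness {a? = pairSquareFree?} _
  where
  pairSquareFree? : Dec PairSquareFree
  pairSquareFree? = all? λ a → all? λ b → ¬? (a ≟ b) →-dec
    allUpTo? (λ p → (1 ≤? p) →-dec
      allUpTo? (λ r → ¬? (repeats? _≟_ (image 13 leech (pair a b)) r p p)) 13) 3

t-noShortSquareAt : ∀ {p} → p < 3 → 1 ≤ p → ∀ i → t (i ℕ./ 13) ≢ t (suc (i ℕ./ 13)) →
                    ¬ Repeats t i p p
t-noShortSquareAt {p} p<3 1≤p i t≢t rep =
  leech-pairSquareFree _ _ t≢t′ p<3 1≤p (m%n<n i 13) (Repeats-transfer window rep)
  where
  open ≡-Reasoning
  q r : ℕ
  q = i ℕ./ 13
  r = i ℕ.% 13

  t′ : InfWord (Fin 3)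
  t′ x = t (q + x)

  t≢t′ : t′ 0 ≢ t′ 1
  t≢t′ eq = t≢t (trans (cong t (sym (+-identityʳ q))) (trans eq (cong t (+-comm q 1))))

  window : ∀ {j} → j < p + p → t (i + j) ≡ image 13 leech (pair (t′ 0) (t′ 1)) (r + j)
  window {j} j<2p = begin
    t (i + j)                         ≡⟨ cong (λ x → t (x + j)) (position i 13) ⟩
    t (q * 13 + r + j)                ≡⟨ cong t (+-assoc (q * 13) r j) ⟩
    t (q * 13 + (r + j))              ≡⟨ t-fixed (q * 13 + (r + j)) ⟩
    image 13 leech t (q * 13 + (r + j)) ≡⟨ image-shift 13 leech t q (r + j) ⟩
    image 13 leech t′ (r + j)         ≡⟨ image-cong 13 leech 2 (pair-window t′)
      (+-mono-<-≤ (m%n<n i 13) (≤-trans (<⇒≤ j<2p)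
        (+-mono-≤ (≤-trans (≤-pred p<3) (m≤m+n 2 4)) (≤-trans (≤-pred p<3) (m≤m+n 2 5))))) ⟩
    image 13 leech (pair (t′ 0) (t′ 1)) (r + j) ∎

-- For positive `n`, the parent position `n / 13` is smaller, so by induction its letter differs
-- from the next one and the pair check excludes a square of period 1. Position 0 is its own parent
-- and is settled by computation.
t≢ : ∀ n → t n ≢ t (suc n)
t≢ = <-rec (λ n → t n ≢ t (suc n)) step
  where
  step : ∀ n → (∀ {m} → m < n → t m ≢ t (suc m)) → t n ≢ t (suc n)
  step zero      _   = λ ()
  step n@(suc _) rec eq = t-noShortSquareAt {1} (s≤s (s≤s z≤n)) ≤-refl n
    (rec (m/n<m n 13 (s≤s (s≤s z≤n))))
    (repeats λ { {zero} _ → trans (cong t (+-identityʳ n)) (trans eq (cong t (sym (trans (+-identityʳ (n + 1)) (+-comm n 1)))))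
      ; {suc _} (s≤s ()) })

t-noShortSquare : NoShortSquare t
t-noShortSquare p<3 1≤p i = t-noShortSquareAt p<3 1≤p i (t≢ (i ℕ./ 13))

-- Descent on the period: `t` is its own image, so a square of period `p` yields one of period `m`
-- with `p ≡ m * 13`.
t-squareFree : ∀ p → 1 ≤ p → ∀ i → ¬ Repeats t i p p
t-squareFree = <-rec (λ p → 1 ≤ p → ∀ i → ¬ Repeats t i p p) step
  where
  open Avoidance 13 leech leech-admissible t
  step : ∀ p → (∀ {m} → m < p → 1 ≤ m → ∀ i → ¬ Repeats t i m m) →
         1 ≤ p → ∀ i → ¬ Repeats t i p p
  step p rec 1≤p i rep
    with i′ , m , 1≤m , refl , sq ← repetition⇒square t-noShortSquare 1≤p
           (Repeats-transfer {i = i} {i} (λ {j} _ → t-fixed (i + j)) rep)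
    = rec (m<m*n m 13 {{>-nonZero 1≤m}} (s≤s (s≤s z≤n))) 1≤m i′ sq

module _ {A : Set} {f : Fin 3 → ℕ → A} {e : ℕ → ℕ} (adm : Admissible 16 f e) where

  image-avoids : ∀ {i p} → 1 ≤ p → ¬ Repeats (image 16 f t) i p (e p)
  image-avoids 1≤p rep
    with i′ , m , 1≤m , _ , sq ← Avoidance.repetition⇒square 16 f adm t t-noShortSquare 1≤p rep
    = t-squareFree m 1≤m i′ sq

-- Factors, powers and overlaps as repetitions.

applyUpTo-cong : ∀ {f f′ : ℕ → A} n → (∀ {j} → j < n → f j ≡ f′ j) → applyUpTo f n ≡ applyUpTo f′ n
applyUpTo-cong zero    eq = refl
applyUpTo-cong (suc n) eq = cong₂ _∷_ (eq (s≤s z≤n)) (applyUpTo-cong n (eq ∘ s≤s))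

applyUpTo-injective : ∀ {f f′ : ℕ → A} n → applyUpTo f n ≡ applyUpTo f′ n → ∀ {j} → j < n → f j ≡ f′ j
applyUpTo-injective (suc n) eq {zero}  _         = ∷-injectiveˡ eq
applyUpTo-injective (suc n) eq {suc j} (s≤s j<n) = applyUpTo-injective n (∷-injectiveʳ eq) j<n

applyUpTo-++ : ∀ (f : ℕ → A) m n → applyUpTo f (m + n) ≡ applyUpTo f m ++ applyUpTo (f ∘ (λ j → m + j)) n
applyUpTo-++ f zero    n = refl
applyUpTo-++ f (suc m) n = cong (f 0 ∷_) (applyUpTo-++ (f ∘ suc) m n)

applyUpTo-split : ∀ (f : ℕ → A) n x {y} → applyUpTo f n ≡ x ++ y →
                  x ≡ applyUpTo f (length x) × y ≡ applyUpTo (f ∘ (λ j → length x + j)) (length y)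
applyUpTo-split f n       []      eq =
  refl , trans (sym eq) (cong (applyUpTo f) (trans (sym (length-applyUpTo f n)) (cong length eq)))
applyUpTo-split f (suc n) (x ∷ xs) eq with applyUpTo-split (f ∘ suc) n xs (∷-injectiveʳ eq)
... | xs≡ , y≡ = cong₂ _∷_ (sym (∷-injectiveˡ eq)) xs≡ , y≡

module _ (w : InfWord A) where

  length-factor : ∀ i n → length (factor w i n) ≡ n
  length-factor i n = length-applyUpTo (λ k → w (i + k)) n

  factor-++ : ∀ i m n → factor w i (m + n) ≡ factor w i m ++ factor w (i + m) n
  factor-++ i m n = trans (applyUpTo-++ (λ k → w (i + k)) m n)
    (cong (factor w i m ++_) (applyUpTo-cong n λ {j} _ → cong w (sym (+-assoc i m j))))

  factor-split : ∀ i n x {y} → factor w i n ≡ x ++ y →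
                 x ≡ factor w i (length x) × y ≡ factor w (i + length x) (length y)
  factor-split i n x {y} eq with applyUpTo-split (λ k → w (i + k)) n x eq
  ... | x≡ , y≡ = x≡ , trans y≡ (applyUpTo-cong (length y) λ {j} _ → cong w (sym (+-assoc i (length x) j)))

  -- The factor has the border `u`, and its two copies start `length x` apart. Powers and overlaps
  -- both reduce to this.
  border⇒Repeats : ∀ {i n} x u {y} → factor w i n ≡ x ++ u → factor w i n ≡ u ++ y →
                   Repeats w i (length x) (length u)
  border⇒Repeats {i} {n} x u eq eq′ = repeats (applyUpTo-injective (length u)
    (trans (sym (proj₁ (factor-split i n u eq′))) (proj₂ (factor-split i n x eq))))

  Repeats⇒power : ∀ i p k → Repeats w i p (k * p) → factor w i (suc k * p) ≡ factor w i p ^ʷ suc k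
  Repeats⇒power i p zero    rep = trans (cong (factor w i) (+-identityʳ p)) (sym (++-identityʳ _))
  Repeats⇒power i p (suc k) rep = trans (factor-++ i p (suc k * p)) (cong (factor w i p ++_)
    (trans (applyUpTo-cong (suc k * p) (sym ∘ shift-eq rep))
           (Repeats⇒power i p k (Repeats-≤ (m≤n+m (k * p) p) rep))))

^ʷ-suc : ∀ (z : List A) k → z ^ʷ suc k ≡ z ^ʷ k ++ z
^ʷ-suc z zero    = ++-identityʳ z
^ʷ-suc z (suc k) = trans (cong (z ++_) (^ʷ-suc z k)) (sym (++-assoc z (z ^ʷ k) z))

^ʷ-+ : ∀ (z : List A) k l → z ^ʷ (k + l) ≡ z ^ʷ k ++ z ^ʷ l
^ʷ-+ z zero    l = refl
^ʷ-+ z (suc k) l = trans (cong (z ++_) (^ʷ-+ z k l)) (sym (++-assoc z (z ^ʷ k) (z ^ʷ l)))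

length-^ʷ : ∀ (z : List A) k → length (z ^ʷ k) ≡ k * length z
length-^ʷ z zero    = refl
length-^ʷ z (suc k) = trans (length-++ z) (cong (λ x → length z + x) (length-^ʷ z k))

-- Surplus copies of `z` are absorbed into `y`. Hence maximality of `v` only requires refuting
-- exponent `suc v`.
EndsInPower-+ : ∀ {u : List A} k l → EndsInPower u (k + l) → EndsInPower u l
EndsInPower-+ k l (y , z , z≢[] , refl) =
  y ++ z ^ʷ k , z , z≢[] , trans (cong (y ++_) (^ʷ-+ z k l)) (sym (++-assoc y (z ^ʷ k) (z ^ʷ l)))

module _ (w : InfWord A) {N : ℕ} where

  EndsInPower⇒Repeats : ∀ k → EndsInPower (factor w 0 N) (suc k) →
                        ∃₂ λ s p → 1 ≤ p × s + suc k * p ≡ N × Repeats w s p (k * p)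
  EndsInPower⇒Repeats k (y , z , z≢[] , eq) =
    length y , length z , 1≤length z z≢[] , length≡ ,
    subst (Repeats w (length y) (length z)) (length-^ʷ z k)
      (border⇒Repeats w z (z ^ʷ k) power (trans power (^ʷ-suc z k)))
    where
    1≤length : ∀ (z : List A) → z ≢ [] → 1 ≤ length z
    1≤length []      z≢[] = contradiction refl z≢[]
    1≤length (_ ∷ _) _    = s≤s z≤n

    length≡ : length y + suc k * length z ≡ N
    length≡ = trans (cong (λ x → length y + x) (sym (length-^ʷ z (suc k))))
      (trans (sym (length-++ y)) (trans (cong length (sym eq)) (length-factor w 0 N)))

    power : factor w (length y) (length (z ^ʷ suc k)) ≡ z ^ʷ suc k
    power = sym (proj₂ (factor-split w 0 N y eq))

  Repeats⇒EndsInPower : ∀ k {s p} → 1 ≤ p → s + suc k * p ≡ N → Repeats w s p (k * p) →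
                        EndsInPower (factor w 0 N) (suc k)
  Repeats⇒EndsInPower k {s} {p@(suc _)} _ refl rep =
    factor w 0 s , factor w s p , (λ ()) ,
    trans (factor-++ w 0 s (suc k * p)) (cong (factor w 0 s ++_) (Repeats⇒power w s p k rep))

IsCurlingNumber-unique : ∀ {u : List A} {a b} → IsCurlingNumber u a → IsCurlingNumber u b → a ≡ b
IsCurlingNumber-unique (1≤a , a-power , a-max) (1≤b , b-power , b-max) =
  ≤-antisym (b-max _ 1≤a a-power) (a-max _ 1≤b b-power)

IsOverlap⇒Repeats : ∀ (w : InfWord A) {i n} → IsOverlap (factor w i n) →
                    ∃[ p ] 1 ≤ p × Repeats w i p (suc p)
-- The overlap is `z ++ z ++ a ∷ []`, with border `z ++ a ∷ []`.
IsOverlap⇒Repeats w {i} {n} (a , x , eq) = length z , s≤s z≤n ,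
  subst (Repeats w i (length z)) (trans (length-++ z) (+-comm (length z) 1))
    (border⇒Repeats w {i} {n} z (z ++ a ∷ []) (trans eq z++za) (trans eq (trans z++za (sym (++-assoc z (a ∷ []) _)))))
  where
  z : List _
  z = a ∷ x
  z++za : (a ∷ []) ++ x ++ (a ∷ []) ++ x ++ (a ∷ []) ≡ z ++ (z ++ a ∷ [])
  z++za = refl

-- Curling numbers of the prefixes.

infinite : InfWord (Fin 2)
infinite = image 16 h t

curling : InfWord ℕ
curling = image 16 g t

-- Here `a` precedes `b`. The attaining power is sought inside `h b`, whereas a larger one may cross
-- the boundary and is refuted in both blocks. The prefix ends, exclusively, at `17 + r` there;
-- `suc v * p` is at most 8, so the subtraction never truncates.
CurlCheck : Set
CurlCheck = ∀ a b → a ≢ b → ∀ {r} → r < 16 → let v = g b r in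
  (1 ≤ v × v ≤ 3) ×
  (v ≡ 1 ⊎ (∃[ p ] p < 3 × 1 ≤ p × v * p ≤ suc r × Repeats (h b) (suc r ∸ v * p) p (pred v * p))) ×
  (∀ {p} → p < 3 → 1 ≤ p → ¬ Repeats (image 16 h (pair a b)) (17 + r ∸ suc v * p) p (v * p))

curlCheck : CurlCheck
curlCheck = toWitness {a? = curlCheck?} _
  where
  curlCheck? : Dec CurlCheck
  curlCheck? = all? λ a → all? λ b → ¬? (a ≟ b) →-dec allUpTo? (λ r → let v = g b r in
    ((1 ≤? v) ×-dec (v ≤? 3)) ×-dec
    ((v ℕ.≟ 1) ⊎-dec anyUpTo? (λ p → (1 ≤? p) ×-dec (v * p ≤? suc r) ×-dec
      repeats? _≟_ (h b) (suc r ∸ v * p) p (pred v * p)) 3) ×-dec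
    allUpTo? (λ p → (1 ≤? p) →-dec
      ¬? (repeats? _≟_ (image 16 h (pair a b)) (17 + r ∸ suc v * p) p (v * p))) 3) 16

-- Prepending a letter to t gives the first block of h t a left neighbour.
1∷t : InfWord (Fin 3)
1∷t zero    = 1F
1∷t (suc n) = t n

-- Prepending `1F` keeps neighbours distinct because `t 0` is `0F`.
1∷t-≢ : ∀ n → 1∷t n ≢ t n
1∷t-≢ zero    = λ ()
1∷t-≢ (suc n) = t≢ n

module _ (n : ℕ) where

  private
    q r v : ℕ
    q = n ℕ./ 16
    r = n ℕ.% 16
    v = curling n

    n≡ : n ≡ q * 16 + r
    n≡ = position n 16

    r<16 : r < 16
    r<16 = m%n<n n 16

    checked : _
    checked = curlCheck (1∷t q) (t q) (1∷t-≢ q) r<16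

  1≤curling : 1 ≤ v
  1≤curling = proj₁ (proj₁ checked)

  curling≤3 : v ≤ 3
  curling≤3 = proj₂ (proj₁ checked)

  curling-attained : EndsInPower (factor infinite 0 (suc n)) v
  curling-attained with proj₁ (proj₂ checked)
  -- The whole prefix is its own first power.
  ... | inj₁ v≡1 = subst (EndsInPower _) (sym v≡1) ([] , _ , (λ ()) , sym (++-identityʳ _))
  ... | inj₂ (p , p<3 , 1≤p , vp≤1+r , rep) =
    subst (EndsInPower _) 1+[v-1]≡v
      (Repeats⇒EndsInPower infinite (pred v) {s = q * 16 + s} 1≤p end (Repeats-transfer window rep))
    where
    s : ℕ
    s = suc r ∸ v * p

    1+[v-1]≡v : suc (pred v) ≡ v
    1+[v-1]≡v = suc-pred v {{>-nonZero 1≤curling}}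

    end : q * 16 + s + suc (pred v) * p ≡ suc n
    end = begin
      q * 16 + s + suc (pred v) * p  ≡⟨ cong (λ x → q * 16 + s + x * p) 1+[v-1]≡v ⟩
      q * 16 + s + v * p             ≡⟨ +-assoc (q * 16) s (v * p) ⟩
      q * 16 + (s + v * p)           ≡⟨ cong (λ x → q * 16 + x) (m∸n+n≡m vp≤1+r) ⟩
      q * 16 + suc r                 ≡⟨ +-suc (q * 16) r ⟩
      suc (q * 16 + r)               ≡⟨ cong suc n≡ ⟨
      suc n                          ∎
      where open ≡-Reasoning

    window : ∀ {j} → j < p + pred v * p → h (t q) (s + j) ≡ infinite (q * 16 + s + j)
    window {j} j<vp = sym (trans (cong infinite (+-assoc (q * 16) s j))
      (image-block 16 h t q (begin-strict
        s + j                    <⟨ +-monoʳ-< s j<vp ⟩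
        s + suc (pred v) * p     ≡⟨ cong (λ x → s + x * p) 1+[v-1]≡v ⟩
        s + v * p                ≡⟨ m∸n+n≡m vp≤1+r ⟩
        suc r                    ≤⟨ r<16 ⟩
        16                       ∎)))
      where open ≤-Reasoning

  curling-exceeded : ¬ EndsInPower (factor infinite 0 (suc n)) (suc v)
  curling-exceeded power with EndsInPower⇒Repeats infinite v power
  ... | s , p , 1≤p , end , rep with p <? 3
  -- As `v` is at least 1, the power contains a square, and `hBound` forbids squares of period 3 or
  -- more.
  ... | no  p≮3 = image-avoids h-admissible 1≤p
    (Repeats-≤ (≤-trans (≤-reflexive (hBound-id (≮⇒≥ p≮3)))
                        (m≤n*m p v {{>-nonZero 1≤curling}})) rep)
  ... | yes p<3 = proj₂ (proj₂ checked) p<3 1≤p (Repeats-transfer window rep)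
    where
    -- The start relative to block `q` of `image 16 h 1∷t`, which is the left neighbour of block `q`
    -- of `infinite`.
    s′ : ℕ
    s′ = 17 + r ∸ suc v * p

    power≤ : suc v * p ≤ 17 + r
    power≤ = ≤-trans (*-mono-≤ (s≤s curling≤3) (≤-pred p<3)) (≤-trans (m≤m+n 8 9) (m≤m+n 17 r))

    start : 16 + s ≡ q * 16 + s′
    start = +-cancelʳ-≡ (suc v * p) _ _ (begin
      16 + s + suc v * p         ≡⟨ +-assoc 16 s (suc v * p) ⟩
      16 + (s + suc v * p)       ≡⟨ cong (λ x → 16 + x) end ⟩
      17 + n                     ≡⟨ cong (λ x → 17 + x) n≡ ⟩
      17 + (q * 16 + r)          ≡⟨ regroup (q * 16) r ⟩
      q * 16 + (17 + r)          ≡⟨ cong (λ x → q * 16 + x) (m∸n+n≡m power≤) ⟨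
      q * 16 + (s′ + suc v * p)  ≡⟨ +-assoc (q * 16) s′ (suc v * p) ⟨
      q * 16 + s′ + suc v * p    ∎)
      where
      open ≡-Reasoning
      regroup : ∀ a b → 17 + (a + b) ≡ a + (17 + b)
      regroup = solve-∀

    t′ : InfWord (Fin 3)
    t′ x = 1∷t (q + x)

    t′-pair : ∀ {x} → x < 2 → t′ x ≡ pair (1∷t q) (t q) x
    t′-pair {0} _ = cong 1∷t (+-identityʳ q)
    t′-pair {1} _ = cong 1∷t (+-comm q 1)
    t′-pair {suc (suc _)} (s≤s (s≤s ()))

    window : ∀ {j} → j < p + v * p → infinite (s + j) ≡ image 16 h (pair (1∷t q) (t q)) (s′ + j)
    window {j} j<power = begin
      infinite (s + j)                   ≡⟨ image-shift 16 h 1∷t 1 (s + j) ⟨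
      image 16 h 1∷t (16 + (s + j))      ≡⟨ cong (λ x → image 16 h 1∷t (x + j)) start ⟩
      image 16 h 1∷t (q * 16 + s′ + j)   ≡⟨ cong (image 16 h 1∷t) (+-assoc (q * 16) s′ j) ⟩
      image 16 h 1∷t (q * 16 + (s′ + j)) ≡⟨ image-shift 16 h 1∷t q (s′ + j) ⟩
      image 16 h t′ (s′ + j)             ≡⟨ image-cong 16 h 2 t′-pair s′+j<32 ⟩
      image 16 h (pair (1∷t q) (t q)) (s′ + j) ∎
      where
      open ≡-Reasoning
      s′+j<32 : s′ + j < 32
      s′+j<32 = <-≤-trans (+-monoʳ-< s′ j<power)
        (≤-trans (≤-reflexive (m∸n+n≡m power≤)) (+-monoʳ-≤ 16 r<16))

  curling-correct : IsCurlingNumber (factor infinite 0 (suc n)) v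
  curling-correct = 1≤curling , curling-attained , λ m _ power → ≮⇒≥ λ v<m →
    curling-exceeded (EndsInPower-+ (m ∸ suc v) (suc v)
      (subst (EndsInPower _) (sym (m∸n+n≡m v<m)) power))

-- 3⁺-freeness and overlap-freeness.

HasPeriod⇒Repeats : ∀ (w : InfWord A) i n {p} → HasPeriod (factor w i n) p → Repeats w i p (n ∸ p)
HasPeriod⇒Repeats w i n {p} (_ , p≤len , period) = repeats λ {j} j<n∸p →
  let p+j<n : p + j < n
      p+j<n = subst (p + j <_) (m+[n∸m]≡n (subst (p ≤_) (length-factor w i n) p≤len)) (+-monoʳ-< p j<n∸p)
      a<len : ∀ {x} → x < n → x < length (factor w i n)
      a<len = subst (_ <_) (sym (length-factor w i n))
      a = fromℕ< (a<len (≤-<-trans (m≤n+m j p) p+j<n))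
      b = fromℕ< (a<len p+j<n)
      a≡ : toℕ a ≡ j
      a≡ = toℕ-fromℕ< _
      b≡ : toℕ b ≡ p + j
      b≡ = toℕ-fromℕ< _
  in begin
    w (i + j)                    ≡⟨ cong (λ x → w (i + x)) a≡ ⟨
    w (i + toℕ a)                ≡⟨ lookup-applyUpTo (λ x → w (i + x)) n a ⟨
    lookup (factor w i n) a      ≡⟨ period a b (trans b≡ (trans (+-comm p j) (cong (_+ p) (sym a≡)))) ⟩
    lookup (factor w i n) b      ≡⟨ lookup-applyUpTo (λ x → w (i + x)) n b ⟩
    w (i + toℕ b)                ≡⟨ cong (λ x → w (i + x)) b≡ ⟩
    w (i + (p + j))              ≡⟨ cong w (+-assoc i p j) ⟨
    w (i + p + j)                ∎
  where open ≡-Reasoning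

-- `n / p` is stored in lowest terms, so the comparison passes to the unnormalised fraction, where
-- it is cross-multiplication.
3<n/p⇒3p<n : ∀ n p .{{_ : NonZero p}} → + 3 / 1 ℚ.< + n / p → 3 * p < n
3<n/p⇒3p<n n p@(suc p-1) 3<n/p
  with ℚᵘ.*<* lt ← ℚᵘ.<-respʳ-≃ (ℚ.toℚᵘ-fromℚᵘ (ℚᵘ.mkℚᵘ (+ n) p-1)) (ℚ.toℚᵘ-mono-< 3<n/p)
  = subst (3 * p <_) (*-identityʳ n) (ℤ.drop‿+<+ (subst₂ ℤ._<_ (sym (ℤ.pos-* 3 p)) (sym (ℤ.pos-* n 1)) lt))

infinite-3⁺-free : (+ 3 / 1) ⁺-Free infinite
infinite-3⁺-free (_ , _ , _ , (i , n , refl) , (p , p≢0 , (period@(1≤p , _) , _) , refl) , 3<e) =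
  image-avoids h-admissible 1≤p
    (Repeats-≤ hBound≤n∸p (HasPeriod⇒Repeats infinite i n period))
  where
  3p<n : 3 * p < n
  3p<n = subst (3 * p <_) (length-factor infinite i n) (3<n/p⇒3p<n _ p {{p≢0}} 3<e)

  hBound≤n∸p : hBound p ≤ n ∸ p
  hBound≤n∸p = begin
    hBound p             ≤⟨ hBound≤ 1≤p ⟩
    suc (p + p)          ≡⟨ m+n∸m≡n p _ ⟨
    p + suc (p + p) ∸ p  ≡⟨ cong (_∸ p) (regroup p) ⟩
    suc (3 * p) ∸ p      ≤⟨ ∸-monoˡ-≤ p 3p<n ⟩
    n ∸ p                ∎
    where
    open ≤-Reasoning
    regroup : ∀ p → p + suc (p + p) ≡ suc (3 * p)
    regroup = solve-∀

-- Curling numbers are unique, so the value found by search is the letter certified by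
-- `curling-correct`.
curlingTransform≗curling : ∀ n → curlingTransform _≟_ infinite n ≡ curling n
curlingTransform≗curling n =
  IsCurlingNumber-unique (proj₂ (curlingNumber _≟_ (factor infinite 0 (suc n)) λ ())) (curling-correct n)

curlingTransform-overlapFree : OverlapFree (curlingTransform _≟_ infinite)
curlingTransform-overlapFree (_ , (i , n , refl) , is-overlap)
  with p , 1≤p , rep ← IsOverlap⇒Repeats (curlingTransform _≟_ infinite) is-overlap
  = image-avoids g-admissible 1≤p
      (Repeats-transfer {i = i} {i} (λ {j} _ → curlingTransform≗curling (i + j)) rep)

theorem3 : Σ[ w ∈ InfWord (Fin 2) ]
    ((+ 3 / 1) ⁺-Free w) × OverlapFree (curlingTransform _≟_ w)
theorem3 = infinite , infinite-3⁺-free , curlingTransform-overlapFree
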